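{- Let $k\ge2$ and $m\ge2$ be integers and let $L\subseteq\{0,\dots,k-1\}$ with $0\notin L$ and $1\in L$. Then $r_{\mathrm{sf}}(k,L,m)=O_k\!\left(m^{ -(k-1)}\right)$.
   Context: A sunflower with $t$ petals is a collection of distinct sets $F_1,\dots,F_t$ with $F_i\cap F_j=\bigcap_\ell F_\ell$ for all $i\ne j$; the common intersection is the kernel, and it is an $L$-sunflower if its kernel size lies in $L$. A family avoids intersections of size in $L$ if no two distinct members $F,F'$ satisfy $|F\cap F'|\in L$. $r_{\mathrm{sf}}(k,L,m)$ is the supremum of all $\alpha\ge0$ such that whenever a finite set system $\mathcal F$ of $k$-element sets contains no $L$-sunflower with $m$ petals, there is $\mathcal F'\subseteq\mathcal F$ with $|\mathcal F'|\ge\alpha|\mathcal F|$ avoiding intersections of size in $L$. $O_k$ hides a multiplicative constant depending only on $k$. -}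

module Defs where

open import Data.Nat using (ℕ; _∸_; _^_; _<_; _≤_)
open import Data.Integer using (+_)
open import Data.Rational using (ℚ; _/_; _*_)
import Data.Rational as ℚ
open import Data.List using (List; length)
open import Data.List.Relation.Unary.All using (All)
open import Data.List.Relation.Unary.Unique.Propositional using (Unique)
open import Data.List.Membership.Propositional using (_∈_; _∉_)
open import Data.Fin.Subset using (Subset; _∩_; ⋂; ∣_∣)
open import Data.Product using (Σ; _×_; ∃)
open import Relation.Binary.PropositionalEquality using (_≡_; _≢_)

ℕtoℚ : ℕ → ℚ
ℕtoℚ n = (+ n) / 1

-- A (finite) set system on ground set Fin n: a duplicate-free list of subsets.
-- Every member has exactly k elements.
Uniform : {n : ℕ} → ℕ → List (Subset n) → Set
Uniform k 𝓕 = All (λ F → ∣ F ∣ ≡ k) 𝓕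

SubFamily : {n : ℕ} → List (Subset n) → List (Subset n) → Set
SubFamily P 𝓕 = Unique P × All (_∈ 𝓕) P

IsSunflower : {n : ℕ} → List (Subset n) → Set
IsSunflower P = ∀ {A B} → A ∈ P → B ∈ P → A ≢ B → A ∩ B ≡ ⋂ P

HasLSunflower : {n : ℕ} → List ℕ → ℕ → List (Subset n) → Set
HasLSunflower L m 𝓕 =
  Σ _ λ P → SubFamily P 𝓕 × length P ≡ m × IsSunflower P × ∣ ⋂ P ∣ ∈ L

AvoidsL : {n : ℕ} → List ℕ → List (Subset n) → Set
AvoidsL L 𝓕' = ∀ {A B} → A ∈ 𝓕' → B ∈ 𝓕' → A ≢ B → ∣ A ∩ B ∣ ∉ L

-- α is admissible in the definition of r_sf(k, L, m)
-- (r_sf(k,L,m) is the supremum of the nonnegative admissible α)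
Admissible : ℕ → List ℕ → ℕ → ℚ → Set
Admissible k L m α =
  ∀ (n : ℕ) (𝓕 : List (Subset n)) → Unique 𝓕 → Uniform k 𝓕 →
  (HasLSunflower L m 𝓕 → Data.Empty.⊥) →
  Σ (List (Subset n)) λ 𝓕' → SubFamily 𝓕' 𝓕 × AvoidsL L 𝓕' ×
    (α * ℕtoℚ (length 𝓕)) ℚ.≤ ℕtoℚ (length 𝓕')
  where import Data.Empty

{-# OPTIONS --safe #-}

-- Put q = m - 1 and n = k - 1.  We build a k-partite k-uniform family in which every L-avoiding
-- subfamily has at most 2 q^(-n) times as many members.  One position (position zero, written w
-- below) is distinguished: apart from a negligible exceptional part, an L-avoiding subfamily is
-- injective in its vertex at w, while on average q^n members of the family contain a given vertex at w.
--
-- If 1, ..., k-1 ∈ L, the complete k-partite family [q]^k works.  Otherwise let k′ < k be the largest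
-- positive size outside L, put s = k - k′, and let f range over such a family for k′.  The members of
-- the new family are the tuples (b, f, p, y) with b, p ∈ [q]^s and y from a large set.  The old vertices
-- are (f_j, b), and the i-th new vertex is (y, p_i, b without b_i, f_w).
--
-- No sunflower with q + 1 petals and kernel size in L: the kernel leaves at most q choices for a
-- suitable further vertex, namely f_w (b_i unknown), a vertex of f, or a new one (p_i unknown).
-- The new unbounded choice, that of y, is met only when the kernel consists of all old vertices, and
-- its size is then k′ ∉ L.
--
-- Injectivity: for fixed b, those f which occur with two values of y form an L-avoiding family, so
-- induction applies to them; the remaining f are negligible because y has a large range.  If two
-- members with the same new vertex had different b they would share nothing else, but 1 ∈ L.  So b
-- agrees, then f by induction, and if p did not agree the intersection would have size in (k′, k) ⊆ L.
module Submission where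

open import Defs
open import Data.Bool using (Bool; true; false; T; not; _∨_; _∧_)
import Data.Bool.Properties as Bool
open import Data.Bool.Properties using (T?)
open import Data.Fin as Fin using (Fin; zero; suc)
import Data.Fin.Properties as Fin
import Data.Fin.Subset as S
import Data.Fin.Subset.Properties as S
import Data.Integer as ℤ
import Data.Integer.Properties as ℤ
open import Data.List using (List; []; _∷_; _++_; length; map; filter; cartesianProduct; allFin; lookup)
import Data.List.Properties as List
import Data.List.Membership.DecPropositional as DecMembership
open import Data.List.Membership.Propositional using (_∈_; _∉_)
open import Data.List.Membership.Propositional.Properties
  using (∈-allFin; ∈-lookup; ∈-map⁺; ∈-map⁻; ∈-cartesianProduct⁺; ∈-filter⁺; ∈-filter⁻)
open import Data.List.Relation.Unary.All as All using (All)
open import Data.List.Relation.Unary.AllPairs using ([]; _∷_)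
open import Data.List.Relation.Unary.Any as Any using (here; index; any?)
open import Data.List.Relation.Unary.Any.Properties using (lookup-index)
open import Data.List.Relation.Unary.Unique.Propositional using (Unique)
import Data.List.Relation.Unary.Unique.Propositional.Properties as Unique
open import Data.Nat using (ℕ; zero; suc; _+_; _*_; _∸_; _^_; _<_; _≤_; z≤n; s≤s; s≤s⁻¹; >-nonZero)
open import Data.Nat.Properties
open import Data.Nat.Solver using (module +-*-Solver)
open import Data.Product using (Σ; ∃; ∃₂; _×_; _,_; proj₁; proj₂)
open import Data.Rational using (ℚ)
import Data.Rational as ℚ
import Data.Rational.Properties as ℚ
import Data.Rational.Unnormalised as ℚᵘ
import Data.Rational.Unnormalised.Properties as ℚᵘ
open import Data.Sum using (_⊎_; inj₁; inj₂)
open import Data.Unit using (tt)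
open import Data.Vec as Vec using (Vec; []; _∷_)
import Data.Vec.Properties as Vec
open import Function using (_∘_; case_of_)
open import Relation.Binary.PropositionalEquality
open import Relation.Nullary using (¬_; Dec; yes; no; does; contradiction)
open import Relation.Nullary.Decidable
  using (map′; ⌊_⌋; fromWitness; toWitness; dec-true; dec-false; decidable-stable; ¬?; _×-dec_)
open import Relation.Unary using (Decidable)

-- Finite types, their sizes, and injections between lists

record Finite (A : Set) : Set where
  field
    elems    : List A
    complete : ∀ x → x ∈ elems
    unique   : Unique elems

  size : ℕ
  size = length elems

  abstract
    code : A → Fin size
    code = index ∘ complete

    code-injective : ∀ {x y} → code x ≡ code y → x ≡ y
    code-injective {x} {y} eq =
      trans (lookup-index (complete x)) (trans (cong (lookup elems) eq) (sym (lookup-index (complete y))))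

  ∃? : {P : A → Set} → Decidable P → Dec (∃ P)
  ∃? P? = map′ Any.satisfied (λ (x , px) → Any.map (λ { refl → px }) (complete x)) (any? P? elems)

open Finite

finFinite : ∀ n → Finite (Fin n)
finFinite n = record { elems = allFin n ; complete = ∈-allFin ; unique = Unique.allFin⁺ n }

_×-finite_ : ∀ {A B} → Finite A → Finite B → Finite (A × B)
F ×-finite G = record
  { elems    = cartesianProduct (elems F) (elems G)
  ; complete = λ (x , y) → ∈-cartesianProduct⁺ (complete F x) (complete G y)
  ; unique   = Unique.cartesianProduct⁺ (unique F) (unique G)
  }

cons : ∀ {A : Set} {n} → A × Vec A n → Vec A (suc n)
cons (x , xs) = x ∷ xs

vecFinite : ∀ {A} → Finite A → ∀ n → Finite (Vec A n)
vecFinite F zero    = record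
  { elems = [] ∷ [] ; complete = λ { [] → here refl } ; unique = All.[] ∷ [] }
vecFinite F (suc n) = record
  { elems    = map cons (elems G)
  ; complete = λ { (x ∷ xs) → ∈-map⁺ cons (complete G (x , xs)) }
  ; unique   = Unique.map⁺ (λ { refl → refl }) (unique G)
  }
  where G = F ×-finite vecFinite F n

length-cartesianProduct : ∀ {A B : Set} (xs : List A) (ys : List B) →
  length (cartesianProduct xs ys) ≡ length xs * length ys
length-cartesianProduct []       ys = refl
length-cartesianProduct (x ∷ xs) ys = trans (List.length-++ (map (x ,_) ys))
  (cong₂ _+_ (List.length-map (x ,_) ys) (length-cartesianProduct xs ys))

size-× : ∀ {A B} (F : Finite A) (G : Finite B) → size (F ×-finite G) ≡ size F * size G
size-× F G = length-cartesianProduct (elems F) (elems G)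

size-Fin : ∀ n → size (finFinite n) ≡ n
size-Fin n = List.length-tabulate (λ i → i)

size-Vec : ∀ q n → size (vecFinite (finFinite q) n) ≡ q ^ n
size-Vec q zero    = refl
size-Vec q (suc n) = trans (List.length-map cons (elems (finFinite q ×-finite vecFinite (finFinite q) n)))
  (trans (size-× (finFinite q) (vecFinite (finFinite q) n)) (cong₂ _*_ (size-Fin q) (size-Vec q n)))

0<size : ∀ {A} (F : Finite A) → A → 0 < size F
0<size F x with elems F | complete F x
... | _ ∷ _ | _ = s≤s z≤n

lookup-injective : ∀ {A : Set} {xs : List A} → Unique xs → ∀ {i j} → lookup xs i ≡ lookup xs j → i ≡ j
lookup-injective (_  ∷ _) {zero}  {zero}  _  = refl
lookup-injective (px ∷ _) {zero}  {suc j} eq = contradiction eq (All.lookup px (∈-lookup j))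
lookup-injective (px ∷ _) {suc i} {zero}  eq = contradiction (sym eq) (All.lookup px (∈-lookup i))
lookup-injective (_  ∷ u) {suc i} {suc j} eq = cong suc (lookup-injective u eq)

-- The map `f` may depend on the membership proof, because it is later used to choose preimages of
-- the members of a mapped list.
injection⇒length≤ : ∀ {A B : Set} {xs : List A} {ys : List B} → Unique xs →
  (f : ∀ {x} → x ∈ xs → B) → (∀ {x} (p : x ∈ xs) → f p ∈ ys) →
  (∀ {x y} (p : x ∈ xs) (r : y ∈ xs) → f p ≡ f r → x ≡ y) → length xs ≤ length ys
injection⇒length≤ {xs = xs} {ys} u f f∈ f-inj = Fin.injective⇒≤ {f = g} λ {i} {j} eq →
  lookup-injective u (f-inj (∈-lookup i) (∈-lookup j)
    (trans (lookup-index (f∈ (∈-lookup i)))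
      (trans (cong (lookup ys) eq) (sym (lookup-index (f∈ (∈-lookup j)))))))
  where
  g : Fin (length xs) → Fin (length ys)
  g i = index (f∈ (∈-lookup i))

-- Counting list members that satisfy a Boolean predicate

private variable
  A B : Set

count : (A → Bool) → List A → ℕ
count E xs = length (filter (T? ∘ E) xs)

count-++ : (E : A → Bool) (xs ys : List A) → count E (xs ++ ys) ≡ count E xs + count E ys
count-++ E xs ys = trans (cong length (List.filter-++ (T? ∘ E) xs ys)) (List.length-++ (filter (T? ∘ E) xs))

count-map : (E : B → Bool) (f : A → B) (xs : List A) → count E (map f xs) ≡ count (E ∘ f) xs
count-map E f []       = refl
count-map E f (x ∷ xs) with E (f x)
... | true  = cong suc (count-map E f xs)
... | false = count-map E f xs

count-∨ : (E E′ : A → Bool) (xs : List A) → count (λ x → E x ∨ E′ x) xs ≤ count E xs + count E′ xs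
count-∨ E E′ [] = z≤n
count-∨ E E′ (x ∷ xs) with E x | E′ x
... | true  | true  = s≤s (≤-trans (count-∨ E E′ xs) (+-monoʳ-≤ (count E xs) (n≤1+n _)))
... | true  | false = s≤s (count-∨ E E′ xs)
... | false | true  = ≤-trans (s≤s (count-∨ E E′ xs)) (≤-reflexive (sym (+-suc _ _)))
... | false | false = count-∨ E E′ xs

count-split : (E E′ : A → Bool) (xs : List A) →
  count E xs ≤ count E′ xs + count (λ x → E x ∧ not (E′ x)) xs
count-split E E′ [] = z≤n
count-split E E′ (x ∷ xs) with E x | E′ x
... | true  | true  = s≤s (count-split E E′ xs)
... | true  | false = ≤-trans (s≤s (count-split E E′ xs)) (≤-reflexive (sym (+-suc _ _)))
... | false | true  = ≤-trans (count-split E E′ xs) (n≤1+n _)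
... | false | false = count-split E E′ xs

-- The fibre bounds are summed over `xs`. The factor `c` on the left expresses a density of at most
-- 1/`c` without division.
count-× : ∀ c d (E : A × B → Bool) (xs : List A) (ys : List B) →
  (∀ x → c * count (λ y → E (x , y)) ys ≤ d) → c * count E (cartesianProduct xs ys) ≤ length xs * d
count-× c d E [] ys h = ≤-reflexive (*-zeroʳ c)
count-× c d E (x ∷ xs) ys h = begin
  c * count E (map (x ,_) ys ++ cartesianProduct xs ys)
    ≡⟨ cong (c *_) (count-++ E (map (x ,_) ys) (cartesianProduct xs ys)) ⟩
  c * (count E (map (x ,_) ys) + count E (cartesianProduct xs ys))
    ≡⟨ cong (λ z → c * (z + count E (cartesianProduct xs ys))) (count-map E (x ,_) ys) ⟩
  c * (count (λ y → E (x , y)) ys + count E (cartesianProduct xs ys))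
    ≡⟨ *-distribˡ-+ c _ _ ⟩
  c * count (λ y → E (x , y)) ys + c * count E (cartesianProduct xs ys)
    ≤⟨ +-mono-≤ (h x) (count-× c d E xs ys h) ⟩
  d + length xs * d ∎
  where open ≤-Reasoning

count-false : (xs : List A) → count (λ _ → false) xs ≡ 0
count-false []       = refl
count-false (_ ∷ xs) = count-false xs

count-proj₁ : (E : A → Bool) (xs : List A) (ys : List B) →
  count (E ∘ proj₁) (cartesianProduct xs ys) ≤ count E xs * length ys
count-proj₁ E [] ys = z≤n
count-proj₁ E (x ∷ xs) ys = begin
  count (E ∘ proj₁) (map (x ,_) ys ++ cartesianProduct xs ys)
    ≡⟨ count-++ (E ∘ proj₁) (map (x ,_) ys) (cartesianProduct xs ys) ⟩
  count (E ∘ proj₁) (map (x ,_) ys) + count (E ∘ proj₁) (cartesianProduct xs ys)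
    ≡⟨ cong (_+ count (E ∘ proj₁) (cartesianProduct xs ys)) (count-map (E ∘ proj₁) (x ,_) ys) ⟩
  count (λ _ → E x) ys + count (E ∘ proj₁) (cartesianProduct xs ys)
    ≤⟨ +-monoʳ-≤ (count (λ _ → E x) ys) (count-proj₁ E xs ys) ⟩
  count (λ _ → E x) ys + count E xs * length ys
    ≤⟨ head-bound ⟩
  count E (x ∷ xs) * length ys ∎
  where
  open ≤-Reasoning
  head-bound : count (λ _ → E x) ys + count E xs * length ys ≤ count E (x ∷ xs) * length ys
  head-bound with E x
  ... | true  = +-monoˡ-≤ _ (List.length-filter (λ _ → T? true) ys)
  ... | false = ≤-reflexive (cong (_+ count E xs * length ys) (count-false ys))

count-≤1 : (E : A → Bool) {xs : List A} → Unique xs →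
  (∀ {x y} → T (E x) → T (E y) → x ≡ y) → count E xs ≤ 1
count-≤1 E {xs} u h = injection⇒length≤ {ys = tt ∷ []} (Unique.filter⁺ (T? ∘ E) u) (λ _ → tt) (λ _ → here refl)
  λ p r _ → h (proj₂ (∈-filter⁻ (T? ∘ E) {xs = xs} p)) (proj₂ (∈-filter⁻ (T? ∘ E) {xs = xs} r))

-- Agreement sets of vectors, and deletion of an entry

private variable
  N m n : ℕ

agree : Vec (Fin N) n → Vec (Fin N) n → S.Subset n
agree = Vec.zipWith (λ u v → does (u Fin.≟ v))

agree-++ : ∀ (us us′ : Vec (Fin N) m) (vs vs′ : Vec (Fin N) n) →
  agree (us Vec.++ vs) (us′ Vec.++ vs′) ≡ agree us us′ Vec.++ agree vs vs′
agree-++ us us′ vs vs′ = Vec.zipWith-++ (λ u v → does (u Fin.≟ v)) us vs us′ vs′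

∈-agree⁺ : ∀ (us vs : Vec (Fin N) n) {i} → Vec.lookup us i ≡ Vec.lookup vs i → i S.∈ agree us vs
∈-agree⁺ us vs {i} eq = Vec.lookup⇒[]= i _
  (trans (Vec.lookup-zipWith _ i us vs) (dec-true (Vec.lookup us i Fin.≟ Vec.lookup vs i) eq))

∈-agree⁻ : ∀ (us vs : Vec (Fin N) n) {i} → i S.∈ agree us vs → Vec.lookup us i ≡ Vec.lookup vs i
∈-agree⁻ us vs {i} i∈ with Vec.lookup us i Fin.≟ Vec.lookup vs i in eq
... | yes p = p
... | no _  = case trans (sym (Vec.[]=⇒lookup i∈)) (trans (Vec.lookup-zipWith _ i us vs) (cong does eq)) of λ ()

agree-map : ∀ {M} (f : Fin N → Fin M) → (∀ {u v} → f u ≡ f v → u ≡ v) → (us vs : Vec (Fin N) n) →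
  agree (Vec.map f us) (Vec.map f vs) ≡ agree us vs
agree-map f f-inj []       []       = refl
agree-map f f-inj (u ∷ us) (v ∷ vs) = cong₂ _∷_ same (agree-map f f-inj us vs)
  where
  same : does (f u Fin.≟ f v) ≡ does (u Fin.≟ v)
  same with u Fin.≟ v
  ... | yes refl = dec-true (f u Fin.≟ f u) refl
  ... | no u≢v   = dec-false (f u Fin.≟ f v) (u≢v ∘ f-inj)

∣++∣ : (K : S.Subset m) (M : S.Subset n) → S.∣ K Vec.++ M ∣ ≡ S.∣ K ∣ + S.∣ M ∣
∣++∣ []          M = refl
∣++∣ (true  ∷ K) M = cong suc (∣++∣ K M)
∣++∣ (false ∷ K) M = ∣++∣ K M

∣∣≡0 : {K : S.Subset n} → (∀ i → i S.∉ K) → S.∣ K ∣ ≡ 0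
∣∣≡0 {n} h = trans (cong S.∣_∣ (S.Empty-unique λ (i , p) → h i p)) (S.∣⊥∣≡0 n)

∣∣≡n : {K : S.Subset n} → (∀ i → i S.∈ K) → S.∣ K ∣ ≡ n
∣∣≡n {n} h = trans (cong S.∣_∣ (S.⊆-antisym S.⊆⊤ λ {i} _ → h i)) (S.∣⊤∣≡n n)

∈⇒1≤∣∣ : {K : S.Subset n} {i : Fin n} → i S.∈ K → 1 ≤ S.∣ K ∣
∈⇒1≤∣∣ {K = K} {i} i∈K = subst (_≤ S.∣ K ∣) (S.∣⁅x⁆∣≡1 i)
  (S.p⊆q⇒∣p∣≤∣q∣ λ j∈ → subst (S._∈ K) (sym (S.x∈⁅y⁆⇒x≡y i j∈)) i∈K)

∣∣≡1 : {K : S.Subset n} {i : Fin n} → i S.∈ K → (∀ j → j S.∈ K → j ≡ i) → S.∣ K ∣ ≡ 1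
∣∣≡1 {K = K} {i} i∈K h = trans (cong S.∣_∣ (S.⊆-antisym
  (λ {j} j∈ → subst (S._∈ S.⁅ i ⁆) (sym (h j j∈)) (S.x∈⁅x⁆ i))
  λ j∈ → subst (S._∈ K) (sym (S.x∈⁅y⁆⇒x≡y i j∈)) i∈K)) (S.∣⁅x⁆∣≡1 i)

∈-++ˡ : (K : S.Subset m) (M : S.Subset n) {i : Fin m} → i S.∈ K → (i Fin.↑ˡ n) S.∈ K Vec.++ M
∈-++ˡ K M {i} i∈ = Vec.lookup⇒[]= _ _ (trans (Vec.lookup-++ˡ K M i) (Vec.[]=⇒lookup i∈))

∈-++ʳ : (K : S.Subset m) (M : S.Subset n) {i : Fin n} → i S.∈ M → (m Fin.↑ʳ i) S.∈ K Vec.++ M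
∈-++ʳ K M {i} i∈ = Vec.lookup⇒[]= _ _ (trans (Vec.lookup-++ʳ K M i) (Vec.[]=⇒lookup i∈))

∈-++ˡ⁻ : (K : S.Subset m) (M : S.Subset n) {i : Fin m} → (i Fin.↑ˡ n) S.∈ K Vec.++ M → i S.∈ K
∈-++ˡ⁻ K M {i} i∈ = Vec.lookup⇒[]= _ _ (trans (sym (Vec.lookup-++ˡ K M i)) (Vec.[]=⇒lookup i∈))

∈-++ʳ⁻ : (K : S.Subset m) (M : S.Subset n) {i : Fin n} → (m Fin.↑ʳ i) S.∈ K Vec.++ M → i S.∈ M
∈-++ʳ⁻ K M {i} i∈ = Vec.lookup⇒[]= _ _ (trans (sym (Vec.lookup-++ʳ K M i)) (Vec.[]=⇒lookup i∈))

lookup-ext : ∀ {us vs : Vec A n} → (∀ i → Vec.lookup us i ≡ Vec.lookup vs i) → us ≡ vs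
lookup-ext {us = []}     {[]}     h = refl
lookup-ext {us = u ∷ us} {v ∷ vs} h = cong₂ _∷_ (h zero) (lookup-ext (h ∘ suc))

removeAt-lookup : ∀ (us vs : Vec A (suc n)) i →
  Vec.removeAt us i ≡ Vec.removeAt vs i → Vec.lookup us i ≡ Vec.lookup vs i → us ≡ vs
removeAt-lookup us vs i eq eqᵢ = trans (sym (Vec.insertAt-removeAt us i))
  (trans (cong₂ (λ w u → Vec.insertAt w i u) eq eqᵢ) (Vec.insertAt-removeAt vs i))

-- Deleting entry `i` leaves every other entry readable. With `removeAt-lookup` it follows that the
-- deletions at two different positions determine a word.
removeAt-≢ : ∀ (us vs : Vec A (suc n)) {i j} → i ≢ j →
  Vec.removeAt us i ≡ Vec.removeAt vs i → Vec.lookup us j ≡ Vec.lookup vs j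
removeAt-≢ us vs {i} {j} i≢j eq = trans (sym (Vec.removeAt-punchOut us i≢j))
  (trans (cong (λ w → Vec.lookup w (Fin.punchOut i≢j)) eq) (Vec.removeAt-punchOut vs i≢j))

missing : (K : S.Subset n) → (∃ λ i → i S.∉ K) ⊎ (∀ i → i S.∈ K)
missing K with Fin.any? (λ i → ¬? (i S.∈? K))
... | yes m = inj₁ m
... | no ¬m = inj₂ λ i → decidable-stable (i S.∈? K) λ i∉ → ¬m (i , i∉)

-- Here `a` stands for membership in a subfamily, `g` for goodness and `e` for an inherited
-- exceptional part. A member outside the combined exceptional part is good and not exceptional in
-- the inherited sense.
excluded : ∀ a g e → T a → ¬ T (e ∨ (a ∧ not g)) → T g × ¬ T e
excluded true _     true  _ ¬e = contradiction _ ¬e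
excluded true true  false _ ¬e = _ , λ ()
excluded true false false _ ¬e = contradiction _ ¬e

-- Vectors as sets: one point in each of n blocks of size N

encode : Vec (Fin N) n → S.Subset (n * N)
encode []       = []
encode (u ∷ us) = S.⁅ u ⁆ Vec.++ encode us

⁅⁆-injective : ∀ {u v : Fin N} → S.⁅ u ⁆ ≡ S.⁅ v ⁆ → u ≡ v
⁅⁆-injective {u = u} {v} eq = S.x∈⁅y⁆⇒x≡y v (subst (u S.∈_) eq (S.x∈⁅x⁆ u))

encode-injective : ∀ {us vs : Vec (Fin N) n} → encode us ≡ encode vs → us ≡ vs
encode-injective {us = []}     {[]}     eq = refl
encode-injective {us = u ∷ us} {v ∷ vs} eq = cong₂ _∷_
  (⁅⁆-injective (Vec.++-injectiveˡ S.⁅ u ⁆ S.⁅ v ⁆ eq)) (encode-injective (Vec.++-injectiveʳ S.⁅ u ⁆ S.⁅ v ⁆ eq))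

∣encode∣ : (us : Vec (Fin N) n) → S.∣ encode us ∣ ≡ n
∣encode∣ []       = refl
∣encode∣ (u ∷ us) = trans (∣++∣ S.⁅ u ⁆ (encode us)) (cong₂ _+_ (S.∣⁅x⁆∣≡1 u) (∣encode∣ us))

∈-⁅⁆∩⁅⁆ : ∀ {u v i : Fin N} → i S.∈ S.⁅ u ⁆ S.∩ S.⁅ v ⁆ → u ≡ v
∈-⁅⁆∩⁅⁆ {u = u} {v} i∈ = let (i∈u , i∈v) = S.x∈p∩q⁻ S.⁅ u ⁆ S.⁅ v ⁆ i∈
  in trans (sym (S.x∈⁅y⁆⇒x≡y u i∈u)) (S.x∈⁅y⁆⇒x≡y v i∈v)

⁅⁆∩⁅⁆⁺ : ∀ {u v : Fin N} → u ≡ v → u S.∈ S.⁅ u ⁆ S.∩ S.⁅ v ⁆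
⁅⁆∩⁅⁆⁺ {u = u} refl = S.x∈p∩q⁺ (S.x∈⁅x⁆ u , S.x∈⁅x⁆ u)

encode-∩ : ∀ (u v : Fin N) (us vs : Vec (Fin N) n) →
  encode (u ∷ us) S.∩ encode (v ∷ vs) ≡ (S.⁅ u ⁆ S.∩ S.⁅ v ⁆) Vec.++ (encode us S.∩ encode vs)
encode-∩ u v us vs = Vec.zipWith-++ _∧_ S.⁅ u ⁆ (encode us) S.⁅ v ⁆ (encode vs)

∣encode∩encode∣ : (us vs : Vec (Fin N) n) → S.∣ encode us S.∩ encode vs ∣ ≡ S.∣ agree us vs ∣
∣encode∩encode∣ []       []       = refl
∣encode∩encode∣ (u ∷ us) (v ∷ vs) = trans (cong S.∣_∣ (encode-∩ u v us vs))
  (trans (∣++∣ (S.⁅ u ⁆ S.∩ S.⁅ v ⁆) _) (trans (cong₂ _+_ head-size (∣encode∩encode∣ us vs))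
    (sym (∣++∣ (does (u Fin.≟ v) ∷ []) (agree us vs)))))
  where
  head-size : S.∣ S.⁅ u ⁆ S.∩ S.⁅ v ⁆ ∣ ≡ S.∣ does (u Fin.≟ v) ∷ [] ∣
  head-size with u Fin.≟ v
  ... | yes refl = trans (cong S.∣_∣ (S.∩-idem S.⁅ u ⁆)) (S.∣⁅x⁆∣≡1 u)
  ... | no  u≢v  = ∣∣≡0 λ i i∈ → u≢v (∈-⁅⁆∩⁅⁆ i∈)

-- A block of the intersection is nonempty exactly when the two entries agree there, so the
-- intersection records the positions of agreement and not only their number.
encode∩encode⇒agree : (us vs us′ vs′ : Vec (Fin N) n) →
  encode us S.∩ encode vs ≡ encode us′ S.∩ encode vs′ → agree us vs ≡ agree us′ vs′
encode∩encode⇒agree []       []       []         []         eq = refl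
encode∩encode⇒agree (u ∷ us) (v ∷ vs) (u′ ∷ us′) (v′ ∷ vs′) eq =
  cong₂ _∷_ heads (encode∩encode⇒agree us vs us′ vs′ (Vec.++-injectiveʳ _ _ split))
  where
  split = trans (sym (encode-∩ u v us vs)) (trans eq (encode-∩ u′ v′ us′ vs′))
  same : S.⁅ u ⁆ S.∩ S.⁅ v ⁆ ≡ S.⁅ u′ ⁆ S.∩ S.⁅ v′ ⁆
  same = Vec.++-injectiveˡ _ _ split
  heads : does (u Fin.≟ v) ≡ does (u′ Fin.≟ v′)
  heads with u Fin.≟ v
  ... | yes u≡v = sym (dec-true  (u′ Fin.≟ v′) (∈-⁅⁆∩⁅⁆ (subst (u S.∈_) same (⁅⁆∩⁅⁆⁺ u≡v))))
  ... | no  u≢v = sym (dec-false (u′ Fin.≟ v′) λ u′≡v′ → u≢v (∈-⁅⁆∩⁅⁆ (subst (u′ S.∈_) (sym same) (⁅⁆∩⁅⁆⁺ u′≡v′))))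

-- Designs: the families carried through the induction

module Construction (L : List ℕ) (0∉L : 0 ∉ L) (1∈L : 1 ∈ L) (q : ℕ) where

  -- Among members agreeing on K at most q vertices occur at some position j ∉ K, so by pigeonhole no
  -- q + 1 distinct members agree exactly on K.
  Next : {I : Set} {N n : ℕ} → (I → Vec (Fin N) n) → S.Subset n → Set
  Next {I} val K = ∃₂ λ j (c : I → Fin q) → j S.∉ K ×
    (∀ x y → (∀ {i} → i S.∈ K → Vec.lookup (val x) i ≡ Vec.lookup (val y) i) →
      c x ≡ c y → Vec.lookup (val x) j ≡ Vec.lookup (val y) j)

  Avoiding : {I : Set} {N n : ℕ} → (I → Vec (Fin N) n) → (I → Bool) → Set
  Avoiding val A = ∀ {x y} → T (A x) → T (A y) → x ≢ y → S.∣ agree (val x) (val y) ∣ ∉ L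

  -- W labels the vertices at position zero, the w of the introduction; E is the exceptional part of A.
  record Design (R n : ℕ) : Set₁ where
    field
      I        : Set
      finI     : Finite I
      point    : I
      vertices : ℕ
      val      : I → Vec (Fin vertices) (suc n)
      val-injective : ∀ {x y} → val x ≡ val y → x ≡ y
      W        : Set
      finW     : Finite W
      ω        : I → W
      ω-zero   : ∀ {x y} → ω x ≡ ω y → Vec.lookup (val x) zero ≡ Vec.lookup (val y) zero
      W-size   : size finW * q ^ n ≤ size finI
      -- The alternative `zero S.∈ K` serves the induction: if a kernel contains a new vertex, the
      -- size of its old part need not lie in `L`, but the old part may contain position zero.
      next     : ∀ K {i} → i S.∉ K → S.∣ K ∣ ∈ L ⊎ zero S.∈ K → Next val K
      sparse   : ∀ A → Avoiding val A → ∃ λ (E : I → Bool) → R * count E (elems finI) ≤ size finI ×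
        (∀ {x y} → T (A x) → T (A y) → ¬ T (E x) → ¬ T (E y) →
          Vec.lookup (val x) zero ≡ Vec.lookup (val y) zero → x ≡ y)

  base : ∀ {R} n → Fin q → (∀ j → 1 ≤ j → j < suc n → j ∈ L) → Design R n
  base {R} n z block = record
    { I = Vec (Fin q) (suc n)
    ; finI = vecFinite (finFinite q) (suc n)
    ; point = Vec.replicate (suc n) z
    ; vertices = q
    ; val = λ x → x
    ; val-injective = λ eq → eq
    ; W = Fin q
    ; finW = finFinite q
    ; ω = λ x → Vec.lookup x zero
    ; ω-zero = λ eq → eq
    ; W-size = ≤-reflexive (trans (cong (_* q ^ n) (size-Fin q)) (sym (size-Vec q (suc n))))
    ; next = λ K {i} i∉K _ → i , (λ x → Vec.lookup x i) , i∉K , λ x y _ eq → eq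
    ; sparse = λ A avoid → (λ _ → false) ,
        ≤-trans (≤-reflexive (trans (cong (R *_) (count-false (elems (vecFinite (finFinite q) (suc n)))))
          (*-zeroʳ R))) z≤n ,
        λ {x} {y} x∈A y∈A _ _ eq → distinct avoid x∈A y∈A eq
    }
    where
    -- Sharing position zero makes the agreement size at least 1, and being distinct makes it at
    -- most `n`; all these sizes lie in `L`.
    distinct : ∀ {A} → Avoiding (λ x → x) A → ∀ {x y} → T (A x) → T (A y) →
      Vec.lookup x zero ≡ Vec.lookup y zero → x ≡ y
    distinct avoid {x} {y} x∈A y∈A eq with Vec.≡-dec Fin._≟_ x y
    ... | yes x≡y = x≡y
    ... | no  x≢y = contradiction
      (block _ (∈⇒1≤∣∣ (∈-agree⁺ x y {zero} eq))
        (≤∧≢⇒< (S.∣p∣≤n (agree x y)) λ full → x≢y (lookup-ext λ i →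
          ∈-agree⁻ x y (subst (i S.∈_) (sym (S.∣p∣≡n⇒p≡⊤ full)) S.∈⊤))))
      (avoid x∈A y∈A x≢y)

  -- Extending a design by new vertices

  module Step {R k s : ℕ} (z : Fin q) (y₀ : Fin (2 * R)) (k∉L : suc k ∉ L)
    (block : ∀ j → suc k < j → j < suc s + suc k → j ∈ L) (D : Design (2 * R) k) where

    open Design D

    -- For given b and p, an f that occurs with a single y contributes at most one member. With 2R
    -- values of y such members are at most a fraction 1/(2R) of all.
    Y = Fin (2 * R)
    Word = Vec (Fin q) (suc s)
    I′ = Word × (I × (Word × Y))

    finB = vecFinite (finFinite q) (suc s)
    finY = finFinite (2 * R)
    finBY = finB ×-finite finY
    finI′ = finB ×-finite (finI ×-finite finBY)

    finOld = finFinite vertices ×-finite finB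
    finNew = finY ×-finite (finFinite q ×-finite (vecFinite (finFinite q) s ×-finite finFinite vertices))

    M = size finNew + size finOld

    oldCode : Word → Fin vertices → Fin M
    oldCode b v = size finNew Fin.↑ʳ code finOld (v , b)

    newCode : Fin (suc s) → I′ → Fin M
    newCode i (b , f , p , y) =
      code finNew (y , Vec.lookup p i , Vec.removeAt b i , Vec.lookup (val f) zero) Fin.↑ˡ size finOld

    new : I′ → Vec (Fin M) (suc s)
    new x = Vec.tabulate λ i → newCode i x

    old : I′ → Vec (Fin M) (suc k)
    old (b , f , _) = Vec.map (oldCode b) (val f)

    -- The new vertices come first, so position zero of the extended design is a new vertex.
    val′ : I′ → Vec (Fin M) (suc s + suc k)
    val′ x = new x Vec.++ old x

    oldCode-injective : ∀ {b b′ v v′} → oldCode b v ≡ oldCode b′ v′ → v ≡ v′ × b ≡ b′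
    oldCode-injective eq with refl ← code-injective finOld (Fin.↑ʳ-injective (size finNew) _ _ eq) = refl , refl

    New : Fin (suc s) → I′ → I′ → Set
    New i (b , f , p , y) (b′ , f′ , p′ , y′) = y ≡ y′ × Vec.lookup p i ≡ Vec.lookup p′ i ×
      Vec.removeAt b i ≡ Vec.removeAt b′ i × Vec.lookup (val f) zero ≡ Vec.lookup (val f′) zero

    Old : Fin (suc k) → I′ → I′ → Set
    Old j (b , f , _) (b′ , f′ , _) = Vec.lookup (val f) j ≡ Vec.lookup (val f′) j × b ≡ b′

    new⁻ : ∀ i x x′ → Vec.lookup (new x) i ≡ Vec.lookup (new x′) i → New i x x′
    new⁻ i x x′ eq = split (code-injective finNew (Fin.↑ˡ-injective (size finOld) _ _
      (trans (sym (Vec.lookup∘tabulate (λ i → newCode i x) i))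
        (trans eq (Vec.lookup∘tabulate (λ i → newCode i x′) i)))))
      where
      split : ∀ {a b c d a′ b′ c′ d′} →
        _≡_ {A = Y × (Fin q × (Vec (Fin q) s × Fin vertices))} (a , b , c , d) (a′ , b′ , c′ , d′) →
        a ≡ a′ × b ≡ b′ × c ≡ c′ × d ≡ d′
      split refl = refl , refl , refl , refl

    new⁺ : ∀ i x x′ → New i x x′ → Vec.lookup (new x) i ≡ Vec.lookup (new x′) i
    new⁺ i x x′ (e₁ , e₂ , e₃ , e₄) = trans (Vec.lookup∘tabulate (λ i → newCode i x) i)
      (trans (cong (λ c → code finNew c Fin.↑ˡ size finOld) (cong₂ _,_ e₁ (cong₂ _,_ e₂ (cong₂ _,_ e₃ e₄))))
        (sym (Vec.lookup∘tabulate (λ i → newCode i x′) i)))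

    old⁻ : ∀ j x x′ → Vec.lookup (old x) j ≡ Vec.lookup (old x′) j → Old j x x′
    old⁻ j x@(b , f , _) x′@(b′ , f′ , _) eq = oldCode-injective
      (trans (sym (Vec.lookup-map j (oldCode b) (val f))) (trans eq (Vec.lookup-map j (oldCode b′) (val f′))))

    old⁺ : ∀ j x x′ → Old j x x′ → Vec.lookup (old x) j ≡ Vec.lookup (old x′) j
    old⁺ j x@(b , f , _) x′@(b′ , f′ , _) (e , refl) = trans (Vec.lookup-map j (oldCode b) (val f))
      (trans (cong (oldCode b) e) (sym (Vec.lookup-map j (oldCode b) (val f′))))

    val-new⁻ : ∀ i x x′ →
      Vec.lookup (val′ x) (i Fin.↑ˡ suc k) ≡ Vec.lookup (val′ x′) (i Fin.↑ˡ suc k) →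
      New i x x′
    val-new⁻ i x x′ eq = new⁻ i x x′ (trans (sym (Vec.lookup-++ˡ (new x) (old x) i))
      (trans eq (Vec.lookup-++ˡ (new x′) (old x′) i)))

    val-new⁺ : ∀ i x x′ → New i x x′ →
      Vec.lookup (val′ x) (i Fin.↑ˡ suc k) ≡ Vec.lookup (val′ x′) (i Fin.↑ˡ suc k)
    val-new⁺ i x x′ h = trans (Vec.lookup-++ˡ (new x) (old x) i)
      (trans (new⁺ i x x′ h) (sym (Vec.lookup-++ˡ (new x′) (old x′) i)))

    val-old⁻ : ∀ j x x′ →
      Vec.lookup (val′ x) (suc s Fin.↑ʳ j) ≡ Vec.lookup (val′ x′) (suc s Fin.↑ʳ j) →
      Old j x x′
    val-old⁻ j x x′ eq = old⁻ j x x′ (trans (sym (Vec.lookup-++ʳ (new x) (old x) j))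
      (trans eq (Vec.lookup-++ʳ (new x′) (old x′) j)))

    val-old⁺ : ∀ j x x′ → Old j x x′ →
      Vec.lookup (val′ x) (suc s Fin.↑ʳ j) ≡ Vec.lookup (val′ x′) (suc s Fin.↑ʳ j)
    val-old⁺ j x x′ h = trans (Vec.lookup-++ʳ (new x) (old x) j)
      (trans (old⁺ j x x′ h) (sym (Vec.lookup-++ʳ (new x′) (old x′) j)))

    size-I′ : size finI′ ≡ q ^ suc s * (size finI * (q ^ suc s * (2 * R)))
    size-I′ = trans (size-× finB (finI ×-finite finBY)) (cong₂ _*_ (size-Vec q (suc s)) (trans (size-× finI finBY)
      (cong (size finI *_) (trans (size-× finB finY) (cong₂ _*_ (size-Vec q (suc s)) (size-Fin (2 * R)))))))

    val′-injective : ∀ {x x′} → val′ x ≡ val′ x′ → x ≡ x′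
    val′-injective {x@(b , f , p , y)} {x′@(b′ , f′ , p′ , y′)} eq =
      cong₂ _,_ (proj₂ (same-old zero)) (cong₂ _,_ (val-injective (lookup-ext (proj₁ ∘ same-old)))
        (cong₂ _,_ (lookup-ext (proj₁ ∘ proj₂ ∘ same-new)) (proj₁ (same-new zero))))
      where
      same-old : ∀ j → Old j x x′
      same-old j = val-old⁻ j x x′ (cong (λ v → Vec.lookup v (suc s Fin.↑ʳ j)) eq)
      same-new : ∀ i → New i x x′
      same-new i = val-new⁻ i x x′ (cong (λ v → Vec.lookup v (i Fin.↑ˡ suc k)) eq)

    -- The last component is a label in `W`, not an element of `Fin vertices`: the latter may
    -- include vertices that never occur at position zero, and these would spoil the average in
    -- `W′-size`.
    W′ = Y × (Fin q × (Vec (Fin q) s × W))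
    finW′ = finY ×-finite (finFinite q ×-finite (vecFinite (finFinite q) s ×-finite finW))

    ω′ : I′ → W′
    ω′ (b , f , p , y) = y , Vec.lookup p zero , Vec.removeAt b zero , ω f

    ω′-zero : ∀ {x x′} → ω′ x ≡ ω′ x′ → Vec.lookup (val′ x) zero ≡ Vec.lookup (val′ x′) zero
    ω′-zero {x} {x′} eq = val-new⁺ zero x x′
      ( cong proj₁ eq , cong (proj₁ ∘ proj₂) eq , cong (proj₁ ∘ proj₂ ∘ proj₂) eq
      , ω-zero (cong (proj₂ ∘ proj₂ ∘ proj₂) eq))

    -- The number of labels grows by the factor 2R q^(s+1) and the number of members by 2R
    -- q^(2(s+1)), so the average gains exactly q^(s+1).
    W′-size : size finW′ * q ^ (s + suc k) ≤ size finI′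
    W′-size = begin
      size finW′ * q ^ (s + suc k)
        ≡⟨ cong₂ _*_ size-W′ (^-distribˡ-+-* q s (suc k)) ⟩
      2 * R * (q * (q ^ s * size finW)) * (q ^ s * (q * q ^ k))
        ≡⟨ solve 5 (λ r q a w c → r :* (q :* (a :* w)) :* (a :* (q :* c)) :=
             q :* a :* (w :* c :* (q :* a :* r))) refl (2 * R) q (q ^ s) (size finW) (q ^ k) ⟩
      q ^ suc s * (size finW * q ^ k * (q ^ suc s * (2 * R)))
        ≤⟨ *-monoʳ-≤ (q ^ suc s) (*-monoˡ-≤ (q ^ suc s * (2 * R)) W-size) ⟩
      q ^ suc s * (size finI * (q ^ suc s * (2 * R)))
        ≡⟨ sym size-I′ ⟩
      size finI′ ∎
      where
      open ≤-Reasoning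
      open +-*-Solver
      finV = vecFinite (finFinite q) s
      size-W′ : size finW′ ≡ 2 * R * (q * (q ^ s * size finW))
      size-W′ = trans (size-× finY (finFinite q ×-finite (finV ×-finite finW)))
        (cong₂ _*_ (size-Fin (2 * R)) (trans (size-× (finFinite q) (finV ×-finite finW))
          (cong₂ _*_ (size-Fin q) (trans (size-× finV finW) (cong (_* size finW) (size-Vec q s))))))

    -- `K₁` and `K₀` are the new and the old positions of the kernel. A new vertex reveals y, f_w
    -- and all but one entry of b; an old vertex reveals b.
    next-split : ∀ (K₁ : S.Subset (suc s)) (K₀ : S.Subset (suc k)) {i} → i S.∉ K₁ Vec.++ K₀ →
      S.∣ K₁ Vec.++ K₀ ∣ ∈ L ⊎ zero S.∈ K₁ Vec.++ K₀ → Next val′ (K₁ Vec.++ K₀)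
    next-split K₁ K₀ {i} i∉K hyp with S.nonempty? K₁
    next-split K₁ K₀ {i} i∉K hyp | yes (a , a∈) with zero S.∈? K₀
    -- Given the vertex at `a`, only the deleted entry of b is missing for the old vertex at
    -- position zero.
    ... | no 0∉ = suc s Fin.↑ʳ zero , (λ (b , _) → Vec.lookup b a) , 0∉ ∘ ∈-++ʳ⁻ K₁ K₀ ,
      λ x@(b , _) x′@(b′ , _) agr c≡ → let (_ , _ , e , e₀) = val-new⁻ a x x′ (agr (∈-++ˡ K₁ K₀ a∈)) in
        val-old⁺ zero x x′ (e₀ , removeAt-lookup b b′ a e c≡)
    ... | yes 0∈ with missing K₀
    -- Position zero of the old part reveals b and allows the inner `next` to be invoked without
    -- knowing that the size of `K₀` lies in `L`.
    ...   | inj₁ (j , j∉) = let (l , c , l∉ , h) = next K₀ j∉ (inj₂ 0∈) in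
      suc s Fin.↑ʳ l , (λ (_ , f , _) → c f) , l∉ ∘ ∈-++ʳ⁻ K₁ K₀ ,
      λ x@(b , f , _) x′@(b′ , f′ , _) agr c≡ → val-old⁺ l x x′
        ( h f f′ (λ {j} j∈ → proj₁ (val-old⁻ j x x′ (agr (∈-++ʳ K₁ K₀ j∈)))) c≡
        , proj₂ (val-old⁻ zero x x′ (agr (∈-++ʳ K₁ K₀ 0∈))))
    ...   | inj₂ full with missing K₁
    -- Now b, f and y are known, so the letter of p at `l` determines the new vertex there.
    ...     | inj₁ (l , l∉) = l Fin.↑ˡ suc k , (λ (_ , _ , p , _) → Vec.lookup p l) , l∉ ∘ ∈-++ˡ⁻ K₁ K₀ ,
      λ x@(b , f , _) x′@(b′ , f′ , _) agr c≡ →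
        let (e , b≡) = val-old⁻ zero x x′ (agr (∈-++ʳ K₁ K₀ 0∈))
            (y≡ , _) = val-new⁻ a x x′ (agr (∈-++ˡ K₁ K₀ a∈))
        in val-new⁺ l x x′ (y≡ , c≡ , cong (λ b → Vec.removeAt b l) b≡ , e)
    ...     | inj₂ full₁ = contradiction i∈K i∉K
      where
      i∈K : i S.∈ K₁ Vec.++ K₀
      i∈K with Fin.splitAt (suc s) i in eq
      ... | inj₁ l = subst (S._∈ K₁ Vec.++ K₀) (Fin.splitAt⁻¹-↑ˡ eq) (∈-++ˡ K₁ K₀ (full₁ l))
      ... | inj₂ l = subst (S._∈ K₁ Vec.++ K₀) (Fin.splitAt⁻¹-↑ʳ eq) (∈-++ʳ K₁ K₀ (full l))
    next-split K₁ K₀ i∉K (inj₂ 0∈) | no empty = contradiction (zero , ∈-++ˡ⁻ K₁ K₀ 0∈) empty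
    next-split K₁ K₀ i∉K (inj₁ K∈L) | no empty with missing K₀
    -- The kernel would consist of all old vertices, the one situation in which y is still free.
    ... | inj₂ full = contradiction (subst (_∈ L) (trans (∣++∣ K₁ K₀)
            (cong₂ _+_ (∣∣≡0 λ i i∈ → empty (i , i∈)) (∣∣≡n full))) K∈L) k∉L
    ... | inj₁ (j , j∉) with S.nonempty? K₀
    ...   | no empty₀ = contradiction (subst (_∈ L) (trans (∣++∣ K₁ K₀)
              (cong₂ _+_ (∣∣≡0 λ i i∈ → empty (i , i∈)) (∣∣≡0 λ i i∈ → empty₀ (i , i∈)))) K∈L) 0∉L
    -- The old vertex at `a` fixes b, so a vertex found in the inner design determines an old
    -- vertex.
    ...   | yes (a , a∈) = let (l , c , l∉ , h) = next K₀ j∉ (inj₁ K₀∈L) in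
      suc s Fin.↑ʳ l , (λ (_ , f , _) → c f) , l∉ ∘ ∈-++ʳ⁻ K₁ K₀ ,
      λ x@(b , f , _) x′@(b′ , f′ , _) agr c≡ → val-old⁺ l x x′
        ( h f f′ (λ {j} j∈ → proj₁ (val-old⁻ j x x′ (agr (∈-++ʳ K₁ K₀ j∈)))) c≡
        , proj₂ (val-old⁻ a x x′ (agr (∈-++ʳ K₁ K₀ a∈))))
      where
      K₀∈L : S.∣ K₀ ∣ ∈ L
      K₀∈L = subst (_∈ L) (trans (∣++∣ K₁ K₀) (cong (_+ S.∣ K₀ ∣) (∣∣≡0 λ i i∈ → empty (i , i∈)))) K∈L

    next′ : ∀ K {i} → i S.∉ K → S.∣ K ∣ ∈ L ⊎ zero S.∈ K → Next val′ K
    next′ K with Vec.splitAt (suc s) K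
    ... | K₁ , K₀ , refl = next-split K₁ K₀

    ∣agree′∣ : ∀ x x′ →
      S.∣ agree (val′ x) (val′ x′) ∣ ≡ S.∣ agree (new x) (new x′) ∣ + S.∣ agree (old x) (old x′) ∣
    ∣agree′∣ x x′ = trans (cong S.∣_∣ (agree-++ (new x) (new x′) (old x) (old x′)))
      (∣++∣ (agree (new x) (new x′)) (agree (old x) (old x′)))

    -- Sparseness of avoiding subfamilies in the extended design

    module Sparse (A : I′ → Bool) (avoid : Avoiding val′ A) where

      Good : Word → I → Set
      Good b f = ∃ λ ((u , u′) : (Word × Y) × (Word × Y)) →
        T (A (b , f , u)) × T (A (b , f , u′)) × proj₂ u ≢ proj₂ u′

      good? : ∀ b f → Dec (Good b f)
      good? b f = ∃? (finBY ×-finite finBY) λ (u , u′) →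
        T? (A (b , f , u)) ×-dec (T? (A (b , f , u′)) ×-dec ¬? (proj₂ u Fin.≟ proj₂ u′))

      -- Two good f, f′ occur with different values of y; the corresponding members share no new vertex.
      separate : ∀ {b f f′} → Good b f → Good b f′ →
        ∃₂ λ u u′ → T (A (b , f , u)) × T (A (b , f′ , u′)) × proj₂ u ≢ proj₂ u′
      separate ((u₁ , _) , a₁ , _) ((u₂ , u₃) , a₂ , a₃ , u₂≢u₃) with proj₂ u₁ Fin.≟ proj₂ u₂
      ... | no  u₁≢u₂ = u₁ , u₂ , a₁ , a₂ , u₁≢u₂
      ... | yes u₁≡u₂ = u₁ , u₃ , a₁ , a₃ , λ u₁≡u₃ → u₂≢u₃ (trans (sym u₁≡u₂) u₁≡u₃)

      -- Members with different y share no new vertex, and for equal b the old positions agree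
      -- exactly where `val f` and `val f′` do. The intersection size is therefore unchanged.
      good-avoiding : ∀ b → Avoiding val (λ f → ⌊ good? b f ⌋)
      good-avoiding b {f} {f′} g g′ f≢f′ ∈L with toWitness {a? = good? b f} g | toWitness {a? = good? b f′} g′
      ... | w | w′ with separate w w′
      ... | u , u′ , a , a′ , y≢y′ = avoid a a′ (λ eq → f≢f′ (cong (proj₁ ∘ proj₂) eq))
          (subst (_∈ L) (sym same) ∈L)
        where
        x = b , f , u
        x′ = b , f′ , u′
        same : S.∣ agree (val′ x) (val′ x′) ∣ ≡ S.∣ agree (val f) (val f′) ∣
        same = trans (∣agree′∣ x x′) (cong₂ _+_
          (∣∣≡0 λ i i∈ → y≢y′ (proj₁ (new⁻ i x x′ (∈-agree⁻ (new x) (new x′) i∈))))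
          (cong S.∣_∣ (agree-map (oldCode b) (λ eq → proj₁ (oldCode-injective eq)) (val f) (val f′))))

      E₀ : Word → I → Bool
      E₀ b = proj₁ (sparse _ (good-avoiding b))

      -- `E₁` is inherited from the inner design, separately for each b. `E₂` holds the members of
      -- `A` whose f occurs with only one y for that b.
      E₁ E₂ E′ : I′ → Bool
      E₁ (b , f , _) = E₀ b f
      E₂ x@(b , f , _) = A x ∧ not (⌊ good? b f ⌋)
      E′ x = E₁ x ∨ E₂ x

      -- Membership in `E₁` ignores p and y, so the inner density bound for each b survives the
      -- product with `finBY`.
      E₁-small : 2 * R * count E₁ (elems finI′) ≤ size finI′
      E₁-small = ≤-trans (count-× (2 * R) _ E₁ (elems finB) (elems (finI ×-finite finBY)) λ b → begin
          2 * R * count (E₀ b ∘ proj₁) (elems (finI ×-finite finBY))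
            ≤⟨ *-monoʳ-≤ (2 * R) (count-proj₁ (E₀ b) (elems finI) (elems finBY)) ⟩
          2 * R * (count (E₀ b) (elems finI) * size finBY)
            ≡⟨ sym (*-assoc (2 * R) _ _) ⟩
          2 * R * count (E₀ b) (elems finI) * size finBY
            ≤⟨ *-monoˡ-≤ (size finBY) (proj₁ (proj₂ (sparse _ (good-avoiding b)))) ⟩
          size finI * size finBY
            ≡⟨ sym (size-× finI finBY) ⟩
          size (finI ×-finite finBY) ∎)
        (≤-reflexive (sym (size-× finB (finI ×-finite finBY))))
        where open ≤-Reasoning

      -- For fixed b, f and p, two values of y in `E₂` would make f good; hence at most one of the
      -- 2R values is hit.
      E₂-small : 2 * R * count E₂ (elems finI′) ≤ size finI′
      E₂-small = ≤-trans (count-× (2 * R) _ E₂ (elems finB) _ λ b →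
        count-× (2 * R) _ (λ u → E₂ (b , u)) (elems finI) _ λ f →
        count-× (2 * R) _ (λ u → E₂ (b , f , u)) (elems finB) _ λ p →
        ≤-trans (*-monoʳ-≤ (2 * R) (count-≤1 (λ y → E₂ (b , f , p , y)) (unique finY) (single b f p)))
          (≤-reflexive (*-identityʳ (2 * R))))
        (≤-reflexive (trans (cong (λ n → n * (size finI * (n * (2 * R)))) (size-Vec q (suc s))) (sym size-I′)))
        where
        single : ∀ b f p {y y′} → T (E₂ (b , f , p , y)) → T (E₂ (b , f , p , y′)) → y ≡ y′
        single b f p {y} {y′} e e′ with A (b , f , p , y) in eq | A (b , f , p , y′) in eq′ | good? b f | y Fin.≟ y′
        ... | true  | true | no ¬g | no y≢y′ = contradiction
          (((p , y) , p , y′) , subst T (sym eq) _ , subst T (sym eq′) _ , y≢y′) ¬g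
        ... | true  | true | no _  | yes y≡y′ = y≡y′

      -- Each of the two parts uses at most half of the allowance 1/R, which is why the inner design
      -- is required with 2R.
      E′-small : R * count E′ (elems finI′) ≤ size finI′
      E′-small = *-cancelˡ-≤ 2 (begin
        2 * (R * count E′ (elems finI′))
          ≡⟨ sym (*-assoc 2 R _) ⟩
        2 * R * count E′ (elems finI′)
          ≤⟨ *-monoʳ-≤ (2 * R) (count-∨ E₁ E₂ (elems finI′)) ⟩
        2 * R * (count E₁ (elems finI′) + count E₂ (elems finI′))
          ≡⟨ *-distribˡ-+ (2 * R) _ _ ⟩
        2 * R * count E₁ (elems finI′) + 2 * R * count E₂ (elems finI′)
          ≤⟨ +-mono-≤ E₁-small E₂-small ⟩
        size finI′ + size finI′
          ≡⟨ cong (size finI′ +_) (sym (+-identityʳ _)) ⟩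
        2 * size finI′ ∎)
        where open ≤-Reasoning

      regular : ∀ b f u → T (A (b , f , u)) → ¬ T (E′ (b , f , u)) → T (⌊ good? b f ⌋) × ¬ T (E₀ b f)
      regular b f u = excluded (A (b , f , u)) ⌊ good? b f ⌋ (E₀ b f)

      -- Members with different b that share a new vertex share nothing else, which 1 ∈ L forbids.
      same-b : ∀ {x x′} → T (A x) → T (A x′) → New zero x x′ → proj₁ x ≡ proj₁ x′
      same-b {x@(b , f , p , y)} {x′@(b′ , f′ , p′ , y′)} a a′ nz@(_ , _ , e , _) with Vec.≡-dec Fin._≟_ b b′
      ... | yes b≡b′ = b≡b′
      ... | no  b≢b′ = contradiction (subst (_∈ L) (sym one) 1∈L) (avoid a a′ (b≢b′ ∘ cong proj₁))
        where
        only-zero : ∀ i → i S.∈ agree (new x) (new x′) → i ≡ zero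
        only-zero i i∈ with zero Fin.≟ i
        ... | yes 0≡i = sym 0≡i
        ... | no  0≢i = contradiction
          (removeAt-lookup b b′ zero e (removeAt-≢ b b′ (0≢i ∘ sym)
            (proj₁ (proj₂ (proj₂ (new⁻ i x x′ (∈-agree⁻ (new x) (new x′) i∈)))))))
          b≢b′
        one : S.∣ agree (val′ x) (val′ x′) ∣ ≡ 1
        one = trans (∣agree′∣ x x′) (cong₂ _+_
          (∣∣≡1 (∈-agree⁺ (new x) (new x′) {zero} (new⁺ zero x x′ nz)) only-zero)
          (∣∣≡0 λ j j∈ → b≢b′ (proj₂ (old⁻ j x x′ (∈-agree⁻ (old x) (old x′) j∈)))))

      -- The two members share all `suc k` old vertices and the new vertex at zero. If p and p′
      -- differ, some new vertex is not shared, so the size falls within `block`.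
      same-p : ∀ {b f p p′ y} → T (A (b , f , p , y)) → T (A (b , f , p′ , y)) →
        Vec.lookup p zero ≡ Vec.lookup p′ zero → p ≡ p′
      same-p {b} {f} {p} {p′} {y} a a′ e with Vec.≡-dec Fin._≟_ p p′
      ... | yes p≡p′ = p≡p′
      ... | no  p≢p′ = contradiction (block _ lower upper) (avoid a a′ (p≢p′ ∘ cong (proj₁ ∘ proj₂ ∘ proj₂)))
        where
        x = b , f , p , y
        x′ = b , f , p′ , y
        total : S.∣ agree (val′ x) (val′ x′) ∣ ≡ S.∣ agree (new x) (new x′) ∣ + suc k
        total = trans (∣agree′∣ x x′) (cong (S.∣ agree (new x) (new x′) ∣ +_)
          (∣∣≡n λ j → ∈-agree⁺ (old x) (old x′) refl))
        lower : suc k < S.∣ agree (val′ x) (val′ x′) ∣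
        lower = subst (suc k <_) (sym total) (+-monoˡ-≤ (suc k)
          (∈⇒1≤∣∣ (∈-agree⁺ (new x) (new x′) {zero} (new⁺ zero x x′ (refl , e , refl , refl)))))
        upper : S.∣ agree (val′ x) (val′ x′) ∣ < suc s + suc k
        upper = subst (_< suc s + suc k) (sym total) (+-monoˡ-< (suc k)
          (≤∧≢⇒< (S.∣p∣≤n (agree (new x) (new x′))) λ full → p≢p′ (lookup-ext λ i →
            proj₁ (proj₂ (new⁻ i x x′ (∈-agree⁻ (new x) (new x′)
              (subst (i S.∈_) (sym (S.∣p∣≡n⇒p≡⊤ full)) S.∈⊤)))))))

      same-f : ∀ {b f f′ u u′} → T (A (b , f , u)) → T (A (b , f′ , u′)) →
        ¬ T (E′ (b , f , u)) → ¬ T (E′ (b , f′ , u′)) →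
        Vec.lookup (val f) zero ≡ Vec.lookup (val f′) zero → f ≡ f′
      same-f {b} {f} {f′} {u} {u′} a a′ ¬e ¬e′ =
        let (g , ¬E) = regular b f u a ¬e ; (g′ , ¬E′) = regular b f′ u′ a′ ¬e′
        in proj₂ (proj₂ (sparse _ (good-avoiding b))) g g′ ¬E ¬E′

      -- The shared vertex gives y, f_w and the first letter of p. The remaining data follow in the
      -- order b, f, p, since `same-f` requires equal b and `same-p` requires equal b and f.
      zero-injective : ∀ {x x′} → T (A x) → T (A x′) → ¬ T (E′ x) → ¬ T (E′ x′) →
        Vec.lookup (val′ x) zero ≡ Vec.lookup (val′ x′) zero → x ≡ x′
      zero-injective {x} {x′} a a′ ¬e ¬e′ eq = from-b a a′ ¬e ¬e′ nz (same-b {x} {x′} a a′ nz)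
        where
        nz = val-new⁻ zero x x′ eq
        from-f : ∀ {b f f′ p p′ y} → T (A (b , f , p , y)) → T (A (b , f′ , p′ , y)) →
          Vec.lookup p zero ≡ Vec.lookup p′ zero → f ≡ f′ → _≡_ {A = I′} (b , f , p , y) (b , f′ , p′ , y)
        from-f {b} {f} {y = y} a a′ ep refl = cong (λ p → b , f , p , y) (same-p a a′ ep)
        from-b : ∀ {x x′} → T (A x) → T (A x′) → ¬ T (E′ x) → ¬ T (E′ x′) → New zero x x′ →
          proj₁ x ≡ proj₁ x′ → x ≡ x′
        from-b {b , f , p , y} {.b , f′ , p′ , .y} a a′ ¬e ¬e′ (refl , ep , _ , ew) refl =
          from-f a a′ ep (same-f {b} {f} {f′} {p , y} {p′ , y} a a′ ¬e ¬e′ ew)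

    step : Design R (s + suc k)
    step = record
      { I = I′ ; finI = finI′
      ; point = Vec.replicate (suc s) z , point , Vec.replicate (suc s) z , y₀
      ; vertices = M ; val = val′ ; val-injective = val′-injective
      ; W = W′ ; finW = finW′ ; ω = ω′ ; ω-zero = λ {x} {x′} → ω′-zero {x} {x′} ; W-size = W′-size
      ; next = next′
      ; sparse = λ A avoid → let open Sparse A avoid in E′ , E′-small , λ {x} {x′} → zero-injective {x} {x′}
      }

  -- Iterating the extension over the sizes outside L

  open DecMembership _≟_ using (_∈?_)

  -- Descends to the next size outside L; s counts the sizes in L skipped since the previous one.
  design : Fin q → ∀ k s R → 0 < R → (∀ j → k < j → j < suc s + k → j ∈ L) → Design R (s + k)
  design z zero    s R 0<R block = base (s + 0) z block
  design z (suc k) s R 0<R block with suc k ∈? L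
  ... | yes k∈L = subst (Design R) (sym (+-suc s k)) (design z k (suc s) R 0<R block′)
    where
    block′ : ∀ j → k < j → j < suc (suc s) + k → j ∈ L
    block′ j k<j j< with m≤n⇒m<n∨m≡n k<j
    ... | inj₁ 1+k<j = block j 1+k<j (subst (j <_) (cong suc (sym (+-suc s k))) j<)
    ... | inj₂ refl  = k∈L
  -- The inner recursion starts with an empty block, so its block hypothesis is vacuous.
  ... | no  k∉L = Step.step {R} {k} {s} z (Fin.fromℕ< 0<2R) k∉L block
    (design z k 0 (2 * R) 0<2R λ j k<j j<1+k → contradiction k<j (≤⇒≯ (s≤s⁻¹ j<1+k)))
    where
    0<2R : 0 < 2 * R
    0<2R = <-≤-trans 0<R (m≤m+n R _)

  -- The set system of a design

  module Family {R n : ℕ} (L< : All (_< suc n) L) (0<q : 0 < q) (D : Design R n) where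
    open Design D

    toSet : I → S.Subset (suc n * vertices)
    toSet x = encode (val x)

    toSet-injective : ∀ {x y} → toSet x ≡ toSet y → x ≡ y
    toSet-injective eq = val-injective (encode-injective eq)

    family : List (S.Subset (suc n * vertices))
    family = map toSet (elems finI)

    family-unique : Unique family
    family-unique = Unique.map⁺ toSet-injective (unique finI)

    family-uniform : Uniform (suc n) family
    family-uniform = All.tabulate λ F∈ → case ∈-map⁻ toSet F∈ of λ { (x , _ , refl) → ∣encode∣ (val x) }

    not-full : ∀ {K : S.Subset (suc n)} → S.∣ K ∣ ∈ L → ∃ λ i → i S.∉ K
    not-full {K} K∈L with missing K
    ... | inj₁ m    = m
    ... | inj₂ full = contradiction (∣∣≡n full) (<⇒≢ (All.lookup L< K∈L))

    -- Any two petals agree exactly on the kernel positions `K`. By pigeonhole on the q values of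
    -- `c`, two of the q + 1 petals also agree at the position `j` outside `K`. Fewer than two
    -- petals are impossible because 0 < q.
    sunflower-free : ¬ HasLSunflower L (suc q) family
    sunflower-free ([] , _ , () , _)
    sunflower-free (_ ∷ [] , _ , 1≡1+q , _) = <⇒≢ 0<q (suc-injective 1≡1+q)
    sunflower-free (P@(_ ∷ _ ∷ _) , (unique-P , P⊆) , size-P , sun , kernel∈L) =
      let K∈L = subst (_∈ L) (trans (cong S.∣_∣ (sym (kernel λ ()))) (∣encode∩encode∣ (val x₀) (val x₁))) kernel∈L
          (_ , i∉K) = not-full K∈L
          (j , c , j∉K , determined) = next K i∉K (inj₁ K∈L)
          (a , b , a<b , c≡) = Fin.pigeonhole (≤-reflexive (sym size-P)) (c ∘ petal)
      in j∉K (subst (j S.∈_) (same-agree (Fin.<⇒≢ a<b)) (∈-agree⁺ (val (petal a)) (val (petal b))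
           (determined (petal a) (petal b)
             (λ {i} i∈K → ∈-agree⁻ (val (petal a)) (val (petal b))
               (subst (i S.∈_) (sym (same-agree (Fin.<⇒≢ a<b))) i∈K))
             c≡)))
      where
      preimage : ∀ i → ∃ λ x → x ∈ elems finI × lookup P i ≡ toSet x
      preimage i = ∈-map⁻ toSet (All.lookup P⊆ (∈-lookup i))
      petal : Fin (length P) → I
      petal i = proj₁ (preimage i)
      x₀ = petal zero
      x₁ = petal (suc zero)
      K = agree (val x₀) (val x₁)
      kernel : ∀ {i j} → i ≢ j → toSet (petal i) S.∩ toSet (petal j) ≡ S.⋂ P
      kernel {i} {j} i≢j = trans (sym (cong₂ S._∩_ (proj₂ (proj₂ (preimage i))) (proj₂ (proj₂ (preimage j)))))
        (sun (∈-lookup i) (∈-lookup j) (i≢j ∘ lookup-injective unique-P))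
      same-agree : ∀ {i j} → i ≢ j → agree (val (petal i)) (val (petal j)) ≡ K
      same-agree {i} {j} i≢j = encode∩encode⇒agree (val (petal i)) (val (petal j)) (val x₀) (val x₁)
        (trans (kernel i≢j) (sym (kernel λ ())))

    module _ (𝓕′ : List (S.Subset (suc n * vertices))) (sub : SubFamily 𝓕′ family) (avoids : AvoidsL L 𝓕′) where
      open DecMembership (Vec.≡-dec {n = suc n * vertices} Bool._≟_) using () renaming (_∈?_ to _∈𝓕?_)

      selected : I → Bool
      selected x = ⌊ toSet x ∈𝓕? 𝓕′ ⌋

      selected⁻ : ∀ {x} → T (selected x) → toSet x ∈ 𝓕′
      selected⁻ {x} a = toWitness {a? = toSet x ∈𝓕? 𝓕′} a

      selected-avoiding : Avoiding val selected
      selected-avoiding {x} {y} a a′ x≢y ∈L = avoids (selected⁻ a) (selected⁻ a′) (x≢y ∘ toSet-injective)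
        (subst (_∈ L) (sym (∣encode∩encode∣ (val x) (val y))) ∈L)

      length≤count : length 𝓕′ ≤ count selected (elems finI)
      length≤count = injection⇒length≤ (proj₁ sub) (λ p → proj₁ (pre p))
        (λ p → ∈-filter⁺ (T? ∘ selected) (proj₁ (proj₂ (pre p)))
          (fromWitness {a? = toSet (proj₁ (pre p)) ∈𝓕? 𝓕′} (subst (_∈ 𝓕′) (proj₂ (proj₂ (pre p))) p)))
        (λ p r eq → trans (proj₂ (proj₂ (pre p))) (trans (cong toSet eq) (sym (proj₂ (proj₂ (pre r))))))
        where
        pre : ∀ {F} → F ∈ 𝓕′ → ∃ λ x → x ∈ elems finI × F ≡ toSet x
        pre p = ∈-map⁻ toSet (All.lookup (proj₂ sub) p)

      E : I → Bool
      E = proj₁ (sparse selected selected-avoiding)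

      rest : I → Bool
      rest x = selected x ∧ not (E x)

      -- Outside `E` the vertex at position zero determines the member, so `ω` is injective there.
      count-rest : count rest (elems finI) ≤ size finW
      count-rest = injection⇒length≤ (Unique.filter⁺ (T? ∘ rest) (unique finI))
        (λ {x} _ → ω x) (λ {x} _ → complete finW (ω x))
        λ {x} {y} p r eq →
          let (a , ¬e)  = T-rest (selected x) (E x) (proj₂ (∈-filter⁻ (T? ∘ rest) {xs = elems finI} p))
              (a′ , ¬e′) = T-rest (selected y) (E y) (proj₂ (∈-filter⁻ (T? ∘ rest) {xs = elems finI} r))
          in proj₂ (proj₂ (sparse selected selected-avoiding)) a a′ ¬e ¬e′ (ω-zero eq)
        where
        T-rest : ∀ a e → T (a ∧ not e) → T a × ¬ T e
        T-rest true false _ = _ , λ ()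

      -- The exceptional part and the rest each contribute at most `size finI` after multiplication
      -- by q^n, which gives the factor 2.
      length-bound : R ≡ q ^ n → length 𝓕′ * q ^ n ≤ 2 * length family
      length-bound R≡ = begin
        length 𝓕′ * q ^ n
          ≤⟨ *-monoˡ-≤ (q ^ n) (≤-trans length≤count (count-split selected E (elems finI))) ⟩
        (count E (elems finI) + count rest (elems finI)) * q ^ n
          ≡⟨ *-distribʳ-+ (q ^ n) (count E (elems finI)) (count rest (elems finI)) ⟩
        count E (elems finI) * q ^ n + count rest (elems finI) * q ^ n
          ≤⟨ +-mono-≤ exceptional (≤-trans (*-monoˡ-≤ (q ^ n) count-rest) W-size) ⟩
        size finI + size finI
          ≡⟨ cong (size finI +_) (sym (+-identityʳ (size finI))) ⟩
        2 * size finI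
          ≡⟨ cong (2 *_) (sym (List.length-map toSet (elems finI))) ⟩
        2 * length family ∎
        where
        open ≤-Reasoning
        exceptional : count E (elems finI) * q ^ n ≤ size finI
        exceptional = ≤-trans (≤-reflexive (trans (*-comm (count E (elems finI)) (q ^ n))
            (cong (_* count E (elems finI)) (sym R≡))))
          (proj₁ (proj₂ (sparse selected selected-avoiding)))

    family-nonempty : 1 ≤ length family
    family-nonempty = ≤-trans (0<size finI point) (≤-reflexive (sym (List.length-map toSet (elems finI))))

-- Transfer of the counting bound to rationals

toℚᵘ-ℕtoℚ : ∀ n → ℚ.toℚᵘ (ℕtoℚ n) ℚᵘ.≃ ℚᵘ.mkℚᵘ (ℤ.+ n) 0
toℚᵘ-ℕtoℚ n = ℚ.toℚᵘ-fromℚᵘ (ℚᵘ.mkℚᵘ (ℤ.+ n) 0)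

ℕtoℚ-* : ∀ m n → ℕtoℚ (m * n) ≡ ℕtoℚ m ℚ.* ℕtoℚ n
ℕtoℚ-* m n = ℚ.toℚᵘ-injective (begin
  ℚ.toℚᵘ (ℕtoℚ (m * n))                       ≈⟨ toℚᵘ-ℕtoℚ (m * n) ⟩
  ℚᵘ.mkℚᵘ (ℤ.+ (m * n)) 0                     ≡⟨ cong (λ z → ℚᵘ.mkℚᵘ z 0) (ℤ.pos-* m n) ⟩
  ℚᵘ.mkℚᵘ (ℤ.+ m) 0 ℚᵘ.* ℚᵘ.mkℚᵘ (ℤ.+ n) 0    ≈⟨ ℚᵘ.*-cong (toℚᵘ-ℕtoℚ m) (toℚᵘ-ℕtoℚ n) ⟨
  ℚ.toℚᵘ (ℕtoℚ m) ℚᵘ.* ℚ.toℚᵘ (ℕtoℚ n)        ≈⟨ ℚ.toℚᵘ-homo-* (ℕtoℚ m) (ℕtoℚ n) ⟨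
  ℚ.toℚᵘ (ℕtoℚ m ℚ.* ℕtoℚ n)                  ∎)
  where open ℚᵘ.≃-Reasoning

ℕtoℚ-mono-≤ : ∀ {m n} → m ≤ n → ℕtoℚ m ℚ.≤ ℕtoℚ n
ℕtoℚ-mono-≤ {m} {n} m≤n = ℚ.toℚᵘ-cancel-≤ (begin
  ℚ.toℚᵘ (ℕtoℚ m)      ≃⟨ toℚᵘ-ℕtoℚ m ⟩
  ℚᵘ.mkℚᵘ (ℤ.+ m) 0    ≤⟨ ℚᵘ.*≤* (ℤ.*-monoʳ-≤-nonNeg (ℤ.+ 1) (ℤ.+≤+ m≤n)) ⟩
  ℚᵘ.mkℚᵘ (ℤ.+ n) 0    ≃⟨ toℚᵘ-ℕtoℚ n ⟨
  ℚ.toℚᵘ (ℕtoℚ n)      ∎)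
  where open ℚᵘ.≤-Reasoning

ℕtoℚ-nonNegative : ∀ n → ℚ.NonNegative (ℕtoℚ n)
ℕtoℚ-nonNegative n = ℚ.nonNegative (ℕtoℚ-mono-≤ {0} {n} z≤n)

ℕtoℚ-positive : ∀ {n} → 1 ≤ n → ℚ.Positive (ℕtoℚ n)
ℕtoℚ-positive 1≤n = ℚ.positive (ℚ.<-≤-trans (ℚ.positive⁻¹ ℚ.1ℚ) (ℕtoℚ-mono-≤ 1≤n))

-- The lower bound on `f′` is multiplied by `Q` and compared with the upper bound; then the positive
-- `f` is cancelled.
ratio-bound : ∀ α f f′ Q c → 1 ≤ f → α ℚ.* ℕtoℚ f ℚ.≤ ℕtoℚ f′ → f′ * Q ≤ c * f → α ℚ.* ℕtoℚ Q ℚ.≤ ℕtoℚ c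
ratio-bound α f f′ Q c 1≤f αf≤f′ f′Q≤cf = ℚ.*-cancelʳ-≤-pos (ℕtoℚ f) {{ℕtoℚ-positive 1≤f}} (begin
  α ℚ.* ℕtoℚ Q ℚ.* ℕtoℚ f    ≡⟨ ℚ.*-assoc α (ℕtoℚ Q) (ℕtoℚ f) ⟩
  α ℚ.* (ℕtoℚ Q ℚ.* ℕtoℚ f)  ≡⟨ cong (α ℚ.*_) (ℚ.*-comm (ℕtoℚ Q) (ℕtoℚ f)) ⟩
  α ℚ.* (ℕtoℚ f ℚ.* ℕtoℚ Q)  ≡⟨ ℚ.*-assoc α (ℕtoℚ f) (ℕtoℚ Q) ⟨
  α ℚ.* ℕtoℚ f ℚ.* ℕtoℚ Q    ≤⟨ ℚ.*-monoʳ-≤-nonNeg (ℕtoℚ Q) {{ℕtoℚ-nonNegative Q}} αf≤f′ ⟩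
  ℕtoℚ f′ ℚ.* ℕtoℚ Q         ≡⟨ ℕtoℚ-* f′ Q ⟨
  ℕtoℚ (f′ * Q)              ≤⟨ ℕtoℚ-mono-≤ f′Q≤cf ⟩
  ℕtoℚ (c * f)               ≡⟨ ℕtoℚ-* c f ⟩
  ℕtoℚ c ℚ.* ℕtoℚ f          ∎)
  where open ℚ.≤-Reasoning

scale-bound : ∀ α Q c r P → ℚ.0ℚ ℚ.≤ α → P ≤ Q * r → α ℚ.* ℕtoℚ Q ℚ.≤ ℕtoℚ c → α ℚ.* ℕtoℚ P ℚ.≤ ℕtoℚ (c * r)
scale-bound α Q c r P 0≤α P≤Qr αQ≤c = begin
  α ℚ.* ℕtoℚ P                ≤⟨ ℚ.*-monoˡ-≤-nonNeg α {{ℚ.nonNegative 0≤α}} (ℕtoℚ-mono-≤ P≤Qr) ⟩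
  α ℚ.* ℕtoℚ (Q * r)          ≡⟨ cong (α ℚ.*_) (ℕtoℚ-* Q r) ⟩
  α ℚ.* (ℕtoℚ Q ℚ.* ℕtoℚ r)   ≡⟨ ℚ.*-assoc α (ℕtoℚ Q) (ℕtoℚ r) ⟨
  α ℚ.* ℕtoℚ Q ℚ.* ℕtoℚ r     ≤⟨ ℚ.*-monoʳ-≤-nonNeg (ℕtoℚ r) {{ℕtoℚ-nonNegative r}} αQ≤c ⟩
  ℕtoℚ c ℚ.* ℕtoℚ r           ≡⟨ ℕtoℚ-* c r ⟨
  ℕtoℚ (c * r)                ∎
  where open ℚ.≤-Reasoning

-- The bound in terms of m instead of q

[1+q]^n≤q^n*2^n : ∀ {q} n → 1 ≤ q → suc q ^ n ≤ q ^ n * 2 ^ n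
[1+q]^n≤q^n*2^n zero    1≤q = ≤-refl
[1+q]^n≤q^n*2^n {q} (suc n) 1≤q = ≤-trans (*-mono-≤ 1+q≤q*2 ([1+q]^n≤q^n*2^n n 1≤q))
  (≤-reflexive ([m*n]*[o*p]≡[m*o]*[n*p] q 2 (q ^ n) (2 ^ n)))
  where
  1+q≤q*2 : suc q ≤ q * 2
  1+q≤q*2 = ≤-trans (+-monoˡ-≤ q 1≤q) (≤-reflexive (trans (cong (q +_) (sym (+-identityʳ q))) (*-comm 2 q)))

theorem3p1 : (k : ℕ) → 2 ≤ k →
    Σ ℚ λ C → (m : ℕ) → 2 ≤ m → (L : List ℕ) → All (_< k) L → 0 ∉ L → 1 ∈ L →
    (α : ℚ) → ℚ.0ℚ ℚ.≤ α → Admissible k L m α →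
    α ℚ.* ℕtoℚ (m ^ (k ∸ 1)) ℚ.≤ C
-- The factor 2 comes from `length-bound`, and 2 ^ n from m = q + 1 ≤ 2q.
theorem3p1 (suc n) _ = ℕtoℚ (2 * 2 ^ n) , bound
  where
  bound : (m : ℕ) → 2 ≤ m → (L : List ℕ) → All (_< suc n) L → 0 ∉ L → 1 ∈ L →
    (α : ℚ) → ℚ.0ℚ ℚ.≤ α → Admissible (suc n) L m α → α ℚ.* ℕtoℚ (m ^ n) ℚ.≤ ℕtoℚ (2 * 2 ^ n)
  bound (suc q) (s≤s 1≤q) L L< 0∉L 1∈L α 0≤α admissible =
    let open Construction L 0∉L 1∈L q
        -- With R = q ^ n the bound on the exceptional part matches the bound on the injective part.
        -- The initial block is empty.
        D = design (Fin.fromℕ< 1≤q) n 0 (q ^ n) (m^n>0 q {{>-nonZero 1≤q}} n)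
          λ j n<j j<1+n → contradiction n<j (≤⇒≯ (s≤s⁻¹ j<1+n))
        open Family L< 1≤q D
        (𝓕′ , sub , avoids , α≤) = admissible _ family family-unique family-uniform sunflower-free
    in scale-bound α (q ^ n) 2 (2 ^ n) (suc q ^ n) 0≤α ([1+q]^n≤q^n*2^n n 1≤q)
         (ratio-bound α (length family) (length 𝓕′) (q ^ n) 2 family-nonempty α≤
           (length-bound 𝓕′ sub avoids refl))
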